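{- Let $G$ be a finite simple connected graph and let $M\subseteq V(G)$ be a distance-edge-monitoring set of $G$. Then, for any two distinct edges $e$ and $e'$ of $G$, we have $P(M,e)\neq P(M,e')$.
   Context: $d_G(x,y)$ denotes the distance between vertices $x,y$ in $G$ (equal to $\infty$ if $x$ and $y$ are in different components, which can happen after deleting an edge), and $G-e$ is the graph obtained from $G$ by deleting the edge $e$. For a set $M$ of vertices and an edge $e$ of $G$, $P(M,e)$ is the set of pairs $(x,y)$ with $x\in M$, $y\in V(G)$ and $d_G(x,y)\neq d_{G-e}(x,y)$ (equivalently, $e$ belongs to all shortest paths between $x$ and $y$ in $G$). A set $M\subseteq V(G)$ is distance-edge-monitoring if $P(M,e)\neq\emptyset$ for every edge $e$ of $G$. -}

module Defs where

open import Data.Fin.Base using (Fin; zero; suc; toℕ)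
open import Data.Fin.Properties using (any?; pigeonhole; toℕ≤pred[n]; _≟_)
open import Data.Fin.Subset using (Subset; _∈_)
open import Data.Nat.Base using (ℕ; zero; suc; _+_; _∸_; _<_; s≤s)
open import Data.Nat.Induction using (<-rec)
open import Data.Nat.Properties
  using (anyUpTo?; _<?_; ≮⇒≥; +-monoˡ-<; m+[n∸m]≡n)
open import Data.Product.Base using (∃; _×_; _,_; proj₁; proj₂)
open import Data.Sum.Base using (_⊎_; inj₁; inj₂)
open import Level using (0ℓ)
open import Relation.Binary.Core using (Rel)
open import Relation.Binary.Definitions using (Decidable; Irreflexive; Symmetric)
open import Relation.Binary.PropositionalEquality
  using (_≡_; _≢_; refl; sym; subst)
open import Relation.Nullary.Construct.Add.Supremum using (_⁺; [_]; ⊤⁺)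
open import Relation.Nullary.Decidable
  using (Dec; yes; no; map′; ¬?; _×-dec_; _⊎-dec_)
open import Relation.Nullary.Negation using (¬_)
open import Relation.Unary using (Pred; Satisfiable)

record Graph (n : ℕ) : Set₁ where
  infix 4 _~_ _~?_
  field
    _~_    : Rel (Fin n) 0ℓ
    _~?_   : Decidable _~_
    ~-sym  : Symmetric _~_
    ~-irr  : Irreflexive _≡_ _~_

private
  variable
    n : ℕ

-- An edge is given by its two endpoints in some order, so each edge of the
-- graph has two presentations, which _≈ᴱ_ identifies.
record Edge (G : Graph n) : Set where
  constructor edge
  open Graph G
  field
    src tgt : Fin n
    adj     : src ~ tgt

module _ {G : Graph n} where

  Joins : Edge G → Rel (Fin n) 0ℓ
  Joins e x y = (x ≡ src × y ≡ tgt) ⊎ (x ≡ tgt × y ≡ src)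
    where open Edge e

  joins? : (e : Edge G) → Decidable (Joins e)
  joins? e x y = (x ≟ src ×-dec y ≟ tgt) ⊎-dec (x ≟ tgt ×-dec y ≟ src)
    where open Edge e

  joins-sym : (e : Edge G) → Symmetric (Joins e)
  joins-sym e (inj₁ (p , q)) = inj₂ (q , p)
  joins-sym e (inj₂ (p , q)) = inj₁ (q , p)

  infix 4 _≈ᴱ_ _≉ᴱ_
  _≈ᴱ_ _≉ᴱ_ : Rel (Edge G) 0ℓ
  e ≈ᴱ e′ = Joins e (Edge.src e′) (Edge.tgt e′)
  e ≉ᴱ e′ = ¬ (e ≈ᴱ e′)

infixl 6 _─_
_─_ : (G : Graph n) → Edge G → Graph n
G ─ e = record
  { _~_   = λ x y → x ~ y × ¬ Joins e x y
  ; _~?_  = λ x y → x ~? y ×-dec ¬? (joins? e x y)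
  ; ~-sym = λ (p , ¬j) → ~-sym p , λ j → ¬j (joins-sym e j)
  ; ~-irr = λ x≡y (p , _) → ~-irr x≡y p
  }
  where open Graph G

module _ (G : Graph n) where
  open Graph G

  data Walk : Fin n → Fin n → ℕ → Set where
    []  : ∀ {x} → Walk x x 0
    _∷_ : ∀ {x y z k} → x ~ y → Walk y z k → Walk x z (suc k)

  Connected : Set
  Connected = ∀ x y → ∃ λ k → Walk x y k

  -- The length of a shortest walk is that of a shortest path; ⊤⁺ is ∞.
  data IsDistance (x y : Fin n) : ℕ ⁺ → Set where
    finite   : ∀ {k} → Walk x y k → (∀ {j} → j < k → ¬ Walk x y j) →
               IsDistance x y [ k ]
    infinite : (∀ {k} → ¬ Walk x y k) → IsDistance x y ⊤⁺

  walk? : ∀ x y k → Dec (Walk x y k)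
  walk? x y zero = map′ (λ { refl → [] }) (λ { [] → refl }) (x ≟ y)
  walk? x y (suc k) =
    map′ (λ (_ , p , w) → p ∷ w) (λ { (p ∷ w) → _ , p , w })
         (any? λ z → x ~? z ×-dec walk? z y k)

  least : ∀ {x y k} → Walk x y k →
          ∃ λ m → Walk x y m × (∀ {j} → j < m → ¬ Walk x y j)
  least {x} {y} {k} = <-rec Goal step k
    where
    Goal : ℕ → Set
    Goal k = Walk x y k → ∃ λ m → Walk x y m × (∀ {j} → j < m → ¬ Walk x y j)

    step : ∀ k → (∀ {j} → j < k → Goal j) → Goal k
    step k rec w with anyUpTo? (walk? x y) k
    ... | yes (j , j<k , w′) = rec j<k w′
    ... | no  none           = k , w , λ j<k w′ → none (_ , j<k , w′)

  vertex : ∀ {x y k} → Walk x y k → Fin (suc k) → Fin n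
  vertex {x = x} w       zero    = x
  vertex         (_ ∷ w) (suc i) = vertex w i

  take : ∀ {x y k} (w : Walk x y k) i → Walk x (vertex w i) (toℕ i)
  take w       zero    = []
  take (p ∷ w) (suc i) = p ∷ take w i

  drop : ∀ {x y k} (w : Walk x y k) i → Walk (vertex w i) y (k ∸ toℕ i)
  drop w       zero    = w
  drop (_ ∷ w) (suc i) = drop w i

  infixr 5 _++_
  _++_ : ∀ {x y z k l} → Walk x y k → Walk y z l → Walk x z (k + l)
  []      ++ w′ = w′
  (p ∷ w) ++ w′ = p ∷ (w ++ w′)

  shorten : ∀ {x y k} → ¬ (k < n) → Walk x y k → ∃ λ j → j < k × Walk x y j
  shorten {y = y} {k} k≮n w
    with i , j , i<j , eq ← pigeonhole (s≤s (≮⇒≥ k≮n)) (vertex w)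
    = toℕ i + (k ∸ toℕ j)
    , subst (toℕ i + (k ∸ toℕ j) <_) (m+[n∸m]≡n (toℕ≤pred[n] j))
            (+-monoˡ-< (k ∸ toℕ j) i<j)
    , take w i ++ subst (λ v → Walk v y (k ∸ toℕ j)) (sym eq) (drop w j)

  distance : ∀ x y → ∃ (IsDistance x y)
  distance x y with anyUpTo? (walk? x y) n
  ... | yes (_ , _ , w) = let (m , w′ , min) = least w in [ m ] , finite w′ min
  ... | no  none        = ⊤⁺ , infinite none′
    where
    none′ : ∀ {k} → ¬ Walk x y k
    none′ w with least w
    ... | m , w′ , min with m <? n
    ...   | yes m<n = none (m , m<n , w′)
    ...   | no  m≮n = let (_ , j<m , w″) = shorten m≮n w′ in min j<m w″

  d : Fin n → Fin n → ℕ ⁺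
  d x y = proj₁ (distance x y)

P : (G : Graph n) → Subset n → Edge G → Pred (Fin n × Fin n) 0ℓ
P G M e (x , y) = x ∈ M × d G x y ≢ d (G ─ e) x y

DistanceEdgeMonitoring : Graph n → Subset n → Set
DistanceEdgeMonitoring G M = ∀ e → ∃⟨ P G M e ⟩

{-# OPTIONS --safe #-}

-- If (x, y) ∈ P(M, e) = P(M, e′), let y′ be the penultimate vertex of a shortest
-- path from x to y.  Its last edge y′y differs from one of e and e′, say f.  A
-- shortest path from x to y′ avoiding f would extend by y′y to a shortest path
-- from x to y avoiding f, so (x, y′) ∈ P(M, f): the distance decreases forever.
module Submission where

open import Defs
open import Data.Nat.Base using (ℕ; zero; suc; s≤s)
open import Data.Nat.Properties using (<-cmp)
open import Data.Empty using (⊥-elim)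
open import Data.Fin.Base using (Fin)
open import Data.Fin.Subset using (Subset)
open import Data.Product.Base using (∃; _×_; _,_; proj₁; proj₂)
open import Data.Sum.Base using (inj₁; inj₂)
open import Relation.Binary.Definitions using (tri<; tri≈; tri>)
open import Relation.Binary.PropositionalEquality
  using (_≡_; _≢_; refl; sym; trans; cong; subst)
open import Relation.Nullary.Construct.Add.Supremum using ([_])
open import Relation.Nullary.Decidable using (yes; no)
open import Relation.Nullary.Negation using (¬_)
open import Relation.Unary using (_≐_)

private
  variable
    n k : ℕ
    x y z : Fin n

module _ {G : Graph n} where
  open Graph G

  -- Used below in contrapositive form: a step that runs along `e` cannot also run along a different
  -- edge `e′`.
  joins-unique : (e e′ : Edge G) → Joins e x y → Joins e′ x y → e ≈ᴱ e′
  joins-unique e e′ j (inj₁ (refl , refl)) = j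
  joins-unique e e′ j (inj₂ (refl , refl)) = joins-sym e j

  infixl 5 _∷ʳ_
  _∷ʳ_ : Walk G x y k → y ~ z → Walk G x z (suc k)
  []      ∷ʳ q = q ∷ []
  (p ∷ w) ∷ʳ q = p ∷ (w ∷ʳ q)

  unsnoc : Walk G x z (suc k) → ∃ λ y → Walk G x y k × y ~ z
  unsnoc (p ∷ [])        = _ , [] , p
  unsnoc (p ∷ w@(_ ∷ _)) = let (y , w′ , q) = unsnoc w in y , p ∷ w′ , q

  isDistance⇒d≡ : IsDistance G x y [ k ] → d G x y ≡ [ k ]
  isDistance⇒d≡ {x} {y} {k} (finite w min) with distance G x y
  ... | _ , infinite none = ⊥-elim (none w)
  ... | _ , finite {l} w′ min′ with <-cmp l k
  ...   | tri< l<k _ _ = ⊥-elim (min l<k w′)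
  ...   | tri≈ _ l≡k _ = cong [_] l≡k
  ...   | tri> _ _ k<l = ⊥-elim (min′ k<l w)

  d≡⇒walk : d G x y ≡ [ k ] → Walk G x y k
  d≡⇒walk {x} {y} eq with subst (IsDistance G x y) eq (proj₂ (distance G x y))
  ... | finite w _ = w

module _ (G : Graph n) where
  open Graph G

  ─-walk : (e : Edge G) → Walk (G ─ e) x y k → Walk G x y k
  ─-walk e []            = []
  ─-walk e ((p , _) ∷ w) = p ∷ ─-walk e w

  -- Deletion creates no walks, so a walk of length `k` that survives it is still a shortest one.
  ─-walk⇒d≡ : (e : Edge G) → IsDistance G x y [ k ] → Walk (G ─ e) x y k →
              d G x y ≡ d (G ─ e) x y
  ─-walk⇒d≡ e D@(finite _ min) w =
    trans (isDistance⇒d≡ D)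
          (sym (isDistance⇒d≡ (finite w λ j<k w′ → min j<k (─-walk e w′))))

  ─-d≢-init : (e : Edge G) → IsDistance G x y [ k ] →
              IsDistance G x z [ suc k ] → y ~ z → ¬ Joins e y z →
              d G x z ≢ d (G ─ e) x z → d G x y ≢ d (G ─ e) x y
  ─-d≢-init e D D′ p ¬j d≢ eq =
    d≢ (─-walk⇒d≡ e D′ (d≡⇒walk (trans (sym eq) (isDistance⇒d≡ D)) ∷ʳ (p , ¬j)))

  isDistance-unsnoc : IsDistance G x z [ suc k ] →
                      ∃ λ y → IsDistance G x y [ k ] × y ~ z
  isDistance-unsnoc (finite w min) =
    let (y , w′ , p) = unsnoc w in
    -- A walk to `y` shorter than `k`, extended by `p`, would undercut the distance to `z`.
    y , finite w′ (λ j<k v → min (s≤s j<k) (v ∷ʳ p)) , p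

  P-≐⇒∉P : (M : Subset n) (e e′ : Edge G) → e ≉ᴱ e′ → P G M e ≐ P G M e′ →
           ∀ k {x y} → IsDistance G x y [ k ] → ¬ P G M e (x , y)
  -- The descent ends here: the empty walk survives every deletion.
  P-≐⇒∉P M e e′ e≉e′ P≐ zero D@(finite [] _) (_ , d≢) = d≢ (─-walk⇒d≡ e D [])
  P-≐⇒∉P M e e′ e≉e′ P≐@(P⊆ , P⊇) (suc k) {x} {z} D xz∈P@(x∈M , d≢)
    with y , D′ , p ← isDistance-unsnoc D
    with joins? e y z
  ... | no ¬j = P-≐⇒∉P M e e′ e≉e′ P≐ k D′ (x∈M , ─-d≢-init e D′ D p ¬j d≢)
  -- The last step runs along `e`, hence not along `e′`: cross over with `P⊆`, shorten the pair with
  -- respect to `e′`, and return with `P⊇`.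
  ... | yes j = P-≐⇒∉P M e e′ e≉e′ P≐ k D′
    (P⊇ (x∈M , ─-d≢-init e′ D′ D p (λ j′ → e≉e′ (joins-unique e e′ j j′))
                         (proj₂ (P⊆ xz∈P))))

proposition2 : ∀ {n : ℕ} (G : Graph n) → Connected G →
    ∀ (M : Subset n) → DistanceEdgeMonitoring G M →
    ∀ (e e′ : Edge G) → e ≉ᴱ e′ → ¬ (P G M e ≐ P G M e′)
proposition2 G connected M monitoring e e′ e≉e′ P≐ =
  let ((x , y) , xy∈P) = monitoring e
      -- Connectedness makes the distance between the monitored pair finite, which gives the descent
      -- its starting `k`.
      (_ , w)          = connected x y
      (k , w′ , min)   = least G w
  in P-≐⇒∉P G M e e′ e≉e′ P≐ k (finite w′ min) xy∈P
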